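{- Let $G=(V,E)$ be a control flow graph, let $p$ be a predicate node with successors $s_1,s_2$ in $G$ and with at least two successors in $A_p$. Assume $V_1\cap V_2=\emptyset$, let $U=V_p\setminus(V_1\cup V_2)$, and assume the cycle $C$ of $A_p$ has an unfolding belonging to $V_1.U^*.(V_2.U^*)^*.V_2.U^*.(V_1.U^*)^*$. Then there is exactly one path $m_1\ldots m_i$ in $C$ belonging to $V_1.U^*.V_2$ and exactly one path $o_1\ldots o_j$ in $C$ belonging to $V_2.U^*.V_1$. Moreover, for nodes $a,b$, the nodes $a,b$ are DOD on $p$ if and only if either $a\in\{m_1,\ldots,m_{i-1}\}$ and $b\in\{o_1,\ldots,o_{j-1}\}$, or $b\in\{m_1,\ldots,m_{i-1}\}$ and $a\in\{o_1,\ldots,o_{j-1}\}$.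
   Context: A control flow graph (CFG) is a finite directed graph $G=(V,E)$ in which every node has at most two outgoing edges; nodes with exactly two outgoing edges are predicate nodes. A path from $n_1$ is a nonempty finite or infinite sequence of nodes with each adjacent pair an edge; it is maximal if it is infinite or its last node has no successor. $V_p$ is the set of nodes occurring on all maximal paths from $p$ in $G$. For $V'\subseteq V$, a $V'$-interval from $x$ to $y$ is a finite path $n_1\ldots n_k$ in $G$ with $k\ge 2$, $n_1=x\in V'$, $n_k=y\in V'$, and $n_i\notin V'$ for $1<i<k$. $A_p$ is the directed graph with node set $V_p$ and an edge $(x,y)$ iff there is a $V_p$-interval from $x$ to $y$ in $G$. The cycle $C$ of $A_p$ is the subgraph of $A_p$ induced by $V_p\setminus\{p\}$; an unfolding of $C$ is a path in $C$ containing each node of $C$ exactly once, viewed as a word over the alphabet $V_p$. For $i\in\{1,2\}$, $V_i$ is the set of nodes $n\in V_p$ such that there is a finite path in $G$ from $s_i$ to $n$ whose nodes other than the last one all lie outside $V_p$ (possibly $n=s_i$). For three distinct nodes $p,a,b$ with $p$ a predicate node with successors $s_1,s_2$, the nodes $a,b$ are DOD on $p$ if all maximal paths from $p$ contain both $a$ and $b$, all maximal paths from $s_1$ contain $a$ before any occurrence of $b$, and all maximal paths from $s_2$ contain $b$ before any occurrence of $a$. Concatenation and Kleene star of sets of nodes are the usual regular-language operations. -}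

module Defs where

open import Data.Fin using (Fin)
open import Data.Fin.Subset using (Subset; ∣_∣) renaming (_∈_ to _∈ₛ_)
open import Data.List using (List; []; _∷_; _++_; _∷ʳ_; [_]; head; last; drop; take; length)
open import Data.List.Membership.Propositional using () renaming (_∈_ to _∈ₗ_)
open import Data.List.Relation.Unary.All using (All)
open import Data.List.Relation.Unary.Linked using (Linked)
open import Data.List.Relation.Unary.Unique.Propositional using (Unique)
open import Data.Maybe using (Maybe; just)
open import Data.Nat using (ℕ; suc; pred; _≤_; _<_)
open import Data.Product using (∃-syntax; _×_)
open import Data.Unit using (⊤)
open import Level using (0ℓ)
open import Relation.Binary using (Rel)
open import Relation.Binary.PropositionalEquality using (_≡_; _≢_)
open import Relation.Nullary using (¬_)
open import Relation.Unary using (Pred; _∈_; _∩_; _∖_; ∁; ｛_｝)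

private
  variable
    V : Set

-- Edges are meant to join elements of Node; this is not a field because all the
-- graphs constructed below satisfy it by definition of their edges.
record Digraph (V : Set) : Set₁ where
  field
    Node : Pred V 0ℓ
    Edge : Rel V 0ℓ

open Digraph public

induced : Digraph V → Pred V 0ℓ → Digraph V
induced D S .Node     = Node D ∩ S
induced D S .Edge x y = Edge D x y × x ∈ S × y ∈ S

-- Finite or infinite sequences.
data Seq (V : Set) : Set where
  finite   : List V → Seq V
  infinite : (ℕ → V) → Seq V

infix 8 _!_

-- Entry at a (zero-based) position, `nothing` past the end.
_!_ : Seq V → ℕ → Maybe V
finite xs  ! i = head (drop i xs)
infinite f ! i = just (f i)

_occursIn_ : V → Seq V → Set
v occursIn π = ∃[ i ] π ! i ≡ just v

_occursIn_beforeAny_ : V → Seq V → V → Set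
a occursIn π beforeAny b =
  ∃[ i ] π ! i ≡ just a × (∀ j → π ! j ≡ just b → i < j)

module _ (D : Digraph V) where

  IsPath : Pred (Seq V) 0ℓ
  IsPath (finite xs)  = xs ≢ [] × All (Node D) xs × Linked (Edge D) xs
  IsPath (infinite f) = (∀ i → f i ∈ Node D) × (∀ i → Edge D (f i) (f (suc i)))

  FinitePath : Pred (List V) 0ℓ
  FinitePath xs = IsPath (finite xs)

  EndsInSink : Pred (Seq V) 0ℓ
  EndsInSink (finite xs)  = ∀ x → last xs ≡ just x → ∀ y → ¬ Edge D x y
  EndsInSink (infinite f) = ⊤

  record MaximalPathFrom (n : V) (π : Seq V) : Set where
    field
      isPath  : IsPath π
      starts  : π ! 0 ≡ just n
      maximal : EndsInSink π

  Interval : Pred V 0ℓ → V → V → Set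
  Interval V′ x y =
    x ∈ V′ × y ∈ V′ × (∃[ ms ] All (∁ V′) ms × FinitePath (x ∷ ms ++ [ y ]))

  Unfolding : Pred (List V) 0ℓ
  Unfolding w = FinitePath w × Unique w × (∀ v → v ∈ Node D → v ∈ₗ w)

AtLeastTwoSuccessors : Digraph V → V → Set
AtLeastTwoSuccessors D p = ∃[ x ] ∃[ y ] x ≢ y × Edge D p x × Edge D p y

Language : Set → Set₁
Language V = Pred (List V) 0ℓ

infixr 7 _·_
infix  8 _⋆

-- A set of nodes as a language of one-letter words.
⟨_⟩ : Pred V 0ℓ → Language V
⟨ S ⟩ w = ∃[ v ] v ∈ S × w ≡ [ v ]

_·_ : Language V → Language V → Language V
(L · M) w = ∃[ u ] ∃[ v ] w ≡ u ++ v × u ∈ L × v ∈ M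

data _⋆ {V : Set} (L : Language V) : Language V where
  ε   : [] ∈ L ⋆
  _∷_ : ∀ {u v} → u ∈ L → v ∈ L ⋆ → (u ++ v) ∈ L ⋆

allButLast : List V → List V
allButLast xs = take (pred (length xs)) xs

record CFG : Set where
  field
    size      : ℕ
    succs     : Fin size → Subset size
    outdegree : ∀ v → ∣ succs v ∣ ≤ 2

  Vertex : Set
  Vertex = Fin size

  graph : Digraph Vertex
  graph .Node _   = ⊤
  graph .Edge x y = y ∈ₛ succs x

module _ (G : CFG) where
  open CFG G

  record PredicateWithSuccessors (p s₁ s₂ : Vertex) : Set where
    field
      twoSuccessors : ∣ succs p ∣ ≡ 2
      distinct      : s₁ ≢ s₂
      edge₁         : Edge graph p s₁
      edge₂         : Edge graph p s₂

  OnAllMaximalPaths : Vertex → Pred Vertex 0ℓ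
  OnAllMaximalPaths p n = ∀ π → MaximalPathFrom graph p π → n occursIn π

  -- The graph A_p.
  A : Vertex → Digraph Vertex
  A p .Node     = OnAllMaximalPaths p
  A p .Edge x y = Interval graph (OnAllMaximalPaths p) x y

  -- The subgraph C of A_p.
  C : Vertex → Digraph Vertex
  C p = induced (A p) (OnAllMaximalPaths p ∖ ｛ p ｝)

  -- V_i is `Entry p s_i`; the empty `ms` is the case n = s.
  Entry : Vertex → Vertex → Pred Vertex 0ℓ
  Entry p s n =
    n ∈ OnAllMaximalPaths p ×
    (∃[ ms ] All (∁ (OnAllMaximalPaths p)) ms
           × head (ms ∷ʳ n) ≡ just s
           × FinitePath graph (ms ∷ʳ n))

  -- The two successors of p are unordered, so either of them may play the role
  -- of s₁; hence DOD is symmetric in a and b.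
  record DOD (p a b : Vertex) : Set where
    field
      p≢a : p ≢ a
      p≢b : p ≢ b
      a≢b : a ≢ b
      {s₁ s₂} : Vertex
      predicate : PredicateWithSuccessors p s₁ s₂
      containBoth : ∀ π → MaximalPathFrom graph p π → a occursIn π × b occursIn π
      aFirst : ∀ π → MaximalPathFrom graph s₁ π → a occursIn π beforeAny b
      bFirst : ∀ π → MaximalPathFrom graph s₂ π → b occursIn π beforeAny a

{-# OPTIONS --safe #-}
module Submission where

-- Let x ≢ y be successors of p in A_p. A walk from p can be rerouted, at its last visit of x or y,
-- so that it avoids one of the two. Hence no sink is reachable from p, every infinite path from a
-- vertex reachable from p visits every node of S = V_p ∖ {p}, and p is never visited again. The same
-- rerouting shows that C is functional: if z had two successors in C, a return from them to z could
-- be turned into a cycle avoiding one of them. The unfolding therefore closes up to a cycle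
-- a l b m a with a ∈ V₁, b ∈ V₂, l free of V₁ and m free of V₂, along which paths of C are determined
-- by their first node: V₁.U*.V₂ can only be matched from a, and V₂.U*.V₁ only from b. A path of G
-- entering C through V₁ then passes the whole arc from a before it can reach the arc from b.

open import Defs
open import Data.Empty using (⊥-elim)
open import Data.Fin.Properties using (_≟_; any?)
open import Data.Fin.Subset using (Subset; ∣_∣) renaming (_∈_ to _∈ₛ_)
open import Data.Fin.Subset.Properties using (_∈?_; x∈p⇒∣p-x∣<∣p∣; x∈p∧x≢y⇒x∈p-y)
open import Data.List using (List; []; _∷_; _++_; _∷ʳ_; [_]; head; last; drop; initLast; _∷ʳ′_)
open import Data.List.Membership.Propositional using () renaming (_∈_ to _∈ₗ_)
open import Data.List.Membership.Propositional.Properties using (∈-++⁺ˡ; ∈-++⁻)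
open import Data.List.Properties using (++-assoc)
open import Data.List.Relation.Binary.Disjoint.Propositional using (Disjoint)
open import Data.List.Relation.Unary.All as All using (All; []; _∷_)
open import Data.List.Relation.Unary.All.Properties using (++⁺; ++⁻)
open import Data.List.Relation.Unary.AllPairs using ([]; _∷_)
open import Data.List.Relation.Unary.Any using (here; there)
open import Data.List.Relation.Unary.Linked as Linked using (Linked; []; [-]; _∷_)
import Data.List.Relation.Unary.Linked.Properties as Linked
open import Data.List.Relation.Unary.Unique.Propositional using (Unique)
open import Data.Maybe using (just)
open import Data.Maybe.Properties using (just-injective)
open import Data.Maybe.Relation.Binary.Connected using (Connected; just)
open import Data.Nat using (ℕ; zero; suc; _+_; _≤_; _<_; s≤s; z≤n; _<?_)
open import Data.Nat.Properties using (≤-trans; <-≤-trans; ≮⇒≥; +-cancelˡ-<; <-asym)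
open import Data.Product using (∃; ∃-syntax; ∃!; _×_; _,_; proj₁; proj₂; map₁; map₂; swap)
open import Data.Sum as Sum using (_⊎_; inj₁; inj₂)
open import Data.Unit using (tt)
open import Function.Base using (_∘_; case_of_)
open import Function.Bundles using (_⇔_; mk⇔)
open import Level using (0ℓ)
open import Relation.Binary using (Rel; DecidableEquality)
open import Relation.Binary.Construct.Closure.ReflexiveTransitive using (Star; ε; _◅_; _◅◅_; map)
open import Relation.Binary.PropositionalEquality using (_≡_; _≢_; refl; sym; trans; cong; subst; ≢-sym)
open import Relation.Nullary using (¬_; Dec; yes; no; contradiction)
open import Relation.Unary using (Pred; _∈_; _∉_; _∪_; _∩_; _∖_; ∁; _⊥_; _⊆_; ｛_｝) renaming (U to Anywhere)

import Data.List.Membership.DecPropositional as DecMembership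

-- Walks and infinite traces of a relation

module _ {V : Set} where

  -- Q constrains every vertex except the last one.
  Walk : Rel V 0ℓ → Pred V 0ℓ → Rel V 0ℓ
  Walk E Q = Star (λ v w → v ∈ Q × E v w)

  Trace : Rel V 0ℓ → V → Pred (ℕ → V) 0ℓ
  Trace E v f = f 0 ≡ v × (∀ i → E (f i) (f (suc i)))

  Avoiding : V → Pred V 0ℓ
  Avoiding n v = v ≢ n

  Linked-∷ : ∀ {E : Rel V 0ℓ} {x y xs} → head xs ≡ just y → E x y → Linked E xs → Linked E (x ∷ xs)
  Linked-∷ {xs = _ ∷ _} refl e L = e ∷ L

  Linked-++⁻ˡ : ∀ {E : Rel V 0ℓ} xs {ys} → Linked E (xs ++ ys) → Linked E xs
  Linked-++⁻ˡ []           _       = []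
  Linked-++⁻ˡ (_ ∷ [])     _       = [-]
  Linked-++⁻ˡ (_ ∷ y ∷ xs) (e ∷ L) = e ∷ Linked-++⁻ˡ (y ∷ xs) L

  Linked-++⁻ʳ : ∀ {E : Rel V 0ℓ} xs {ys} → Linked E (xs ++ ys) → Linked E ys
  Linked-++⁻ʳ []       L = L
  Linked-++⁻ʳ (_ ∷ xs) L = Linked-++⁻ʳ xs (Linked.tail L)

  last-++ : ∀ (xs : List V) {y ys} → last (xs ++ y ∷ ys) ≡ last (y ∷ ys)
  last-++ []           = refl
  last-++ (_ ∷ [])     = refl
  last-++ (_ ∷ x ∷ xs) = last-++ (x ∷ xs)

  last-∷ʳ : ∀ (xs : List V) {y} → last (xs ∷ʳ y) ≡ just y
  last-∷ʳ xs = last-++ xs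

  last-of-∷ : ∀ (x : V) xs → ∃[ z ] last (x ∷ xs) ≡ just z
  last-of-∷ x []       = x , refl
  last-of-∷ _ (y ∷ xs) = last-of-∷ y xs

  All-last : ∀ {Q : Pred V 0ℓ} {xs z} → All Q xs → last xs ≡ just z → Q z
  All-last {xs = _ ∷ []}    (q ∷ _)  refl = q
  All-last {xs = _ ∷ _ ∷ _} (_ ∷ qs) eq   = All-last qs eq

  occurs-finite : ∀ {n : V} xs i → head (drop i xs) ≡ just n → n ∈ₗ xs
  occurs-finite []       zero    ()
  occurs-finite []       (suc i) ()
  occurs-finite (_ ∷ _)  zero    refl = here refl
  occurs-finite (_ ∷ xs) (suc i) eq   = there (occurs-finite xs i eq)

  Unique-++⁻ : ∀ (xs : List V) {ys} → Unique (xs ++ ys) → Disjoint xs ys × Unique xs × Unique ys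
  Unique-++⁻ []       U         = (λ { (() , _) }) , [] , U
  Unique-++⁻ (_ ∷ xs) (x∉ ∷ U)
    with d , Uxs , Uys ← Unique-++⁻ xs U
       | x∉xs , x∉ys ← ++⁻ xs x∉
    = (λ { (here refl , v∈ys) → All.lookup x∉ys v∈ys refl
         ; (there v∈xs , v∈ys) → d (v∈xs , v∈ys) })
    , x∉xs ∷ Uxs , Uys

  module _ {E : Rel V 0ℓ} {Q : Pred V 0ℓ} where

    linked⇒walk : ∀ xs {s z} → Linked E (xs ∷ʳ z) → head (xs ∷ʳ z) ≡ just s → All Q xs → Walk E Q s z
    linked⇒walk []           _         refl _        = ε
    linked⇒walk (_ ∷ [])     (e ∷ _)   refl (q ∷ _)  = (q , e) ◅ ε
    linked⇒walk (_ ∷ y ∷ xs) (e ∷ L)   refl (q ∷ qs) = (q , e) ◅ linked⇒walk (y ∷ xs) L refl qs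

    walk⇒linked : ∀ {s z} → Walk E Q s z →
      ∃[ xs ] All Q xs × head (xs ∷ʳ z) ≡ just s × Linked E (xs ∷ʳ z)
    walk⇒linked ε = [] , [] , refl , [-]
    walk⇒linked ((q , e) ◅ w) with xs , qs , hd , L ← walk⇒linked w =
      _ ∷ xs , q ∷ qs , refl , Linked-∷ hd e L

    walkToLast : ∀ {xs v z} → Linked E xs → All Q xs → v ∈ₗ xs → last xs ≡ just z → Walk E Q v z
    walkToLast {_ ∷ []}    _       _        (here refl) refl = ε
    walkToLast {_ ∷ _ ∷ _} (e ∷ L) (q ∷ qs) (here refl) eq   = (q , e) ◅ walkToLast L qs (here refl) eq
    walkToLast {_ ∷ _ ∷ _} (_ ∷ L) (_ ∷ qs) (there v∈)  eq   = walkToLast L qs v∈ eq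

    -- Here `k` is the length of the walk. Every vertex on it before `z` satisfies `Q`, so a vertex
    -- outside `Q` can occur on `g` only from position `k` on, where `g` runs along `f`.
    prepend : ∀ {v z f} → Walk E Q v z → Trace E z f →
      ∃[ k ] ∃[ g ] Trace E v g × (∀ i {n} → g i ≡ n → n ∉ Q → ∃[ j ] i ≡ k + j × f j ≡ n)
                  × (∀ i → g (k + i) ≡ f i)
    prepend {f = f} ε T = 0 , f , T , (λ i eq _ → i , refl , eq) , (λ _ → refl)
    prepend {v} ((q , e) ◅ w) T
      with k , g , (refl , es) , past , eqs ← prepend w T
      = suc k
      , (λ { zero → v ; (suc i) → g i })
      , (refl , λ { zero → e ; (suc i) → es i })
      , (λ { zero refl v∉Q → contradiction q v∉Q
           ; (suc i) eq n∉Q → let j , i≡ , fj≡ = past i eq n∉Q in j , cong suc i≡ , fj≡ })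
      , eqs

    prefixWalk : ∀ {f : ℕ → V} → (∀ i → E (f i) (f (suc i))) →
      ∀ j → (∀ k → k < j → f k ∈ Q) → Walk E Q (f 0) (f j)
    prefixWalk es zero    _  = ε
    prefixWalk es (suc j) qs =
      (qs 0 (s≤s z≤n) , es 0) ◅ prefixWalk (es ∘ suc) j (λ k k<j → qs (suc k) (s≤s k<j))

  -- The recursion carries a proof of the invariant `R` along with the vertex, because `step`
  -- chooses the next vertex from that proof.
  unfoldTrace : ∀ {E : Rel V 0ℓ} (R : Pred V 0ℓ) → (∀ {v} → R v → ∃[ u ] E v u × R u) →
    ∀ {v} → R v → ∃[ f ] Trace E v f × (∀ i → R (f i))
  unfoldTrace {E} R step {v} r =
    proj₁ ∘ state , (refl , λ i → proj₁ (proj₂ (step (proj₂ (state i))))) , proj₂ ∘ state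
    where
    state : ℕ → ∃ R
    state zero    = v , r
    state (suc i) with u , _ , r′ ← step (proj₂ (state i)) = u , r′

  -- The invariant is a walk back to `v`. When it is used up, the trace stands at `v` and starts a
  -- new round with the edge to `u`.
  loop : ∀ {E : Rel V 0ℓ} {Q : Pred V 0ℓ} {v u} → v ∈ Q → E v u → Walk E Q u v →
    ∃[ f ] Trace E v f × (∀ i → f i ∈ Q)
  loop {E} {Q} {v} q e w = map₂ (map₂ (sat ∘_)) (unfoldTrace (λ u → Walk E Q u v) step ε)
    where
    step : ∀ {x} → Walk E Q x v → ∃[ y ] E x y × Walk E Q y v
    step ε              = _ , e , w
    step ((_ , e′) ◅ w′) = _ , e′ , w′

    sat : ∀ {x} → Walk E Q x v → x ∈ Q
    sat ε             = q
    sat ((q′ , _) ◅ _) = q′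

  Trace-drop : ∀ {E : Rel V 0ℓ} {v u f} j → Trace E v f → f j ≡ u → Trace E u (λ i → f (i + j))
  Trace-drop j (_ , es) eq = eq , λ i → es (i + j)

  module _ (_≟ᵥ_ : DecidableEquality V) where

    -- The tail is settled first, so a vertex equal to `x` or `y` becomes the new start only when
    -- the rest avoids both. That start is one of the two, hence only the other is avoided.
    lastVisit : ∀ {E : Rel V 0ℓ} {x y s z} → x ≢ y → Walk E Anywhere s z →
      Walk E (Avoiding x ∩ Avoiding y) s z ⊎ Walk E (Avoiding y) x z ⊎ Walk E (Avoiding x) y z
    lastVisit x≢y ε = inj₁ ε
    lastVisit {x = x} {y} {s} x≢y ((_ , e) ◅ w) with lastVisit x≢y w
    ... | inj₂ found = inj₂ found
    ... | inj₁ w′ with s ≟ᵥ x | s ≟ᵥ y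
    ...   | yes refl | _        = inj₂ (inj₁ ((x≢y , e) ◅ map (map₁ proj₂) w′))
    ...   | no _     | yes refl = inj₂ (inj₂ ((≢-sym x≢y , e) ◅ map (map₁ proj₁) w′))
    ...   | no s≢x   | no s≢y   = inj₁ (((s≢x , s≢y) , e) ◅ w′)

    firstOccurrence : ∀ (f : ℕ → V) {a} i → f i ≡ a → ∃[ j ] f j ≡ a × (∀ k → k < j → f k ≢ a)
    firstOccurrence f zero eq = 0 , eq , λ _ ()
    firstOccurrence f {a} (suc i) eq with f 0 ≟ᵥ a
    ... | yes eq₀ = 0 , eq₀ , λ _ ()
    ... | no f0≢a with j , fj≡a , before ← firstOccurrence (f ∘ suc) i eq =
      suc j , fj≡a , λ { zero _ → f0≢a ; (suc k) (s≤s k<j) → before k k<j }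

-- Alternating cycles of a functional relation

module _ {V : Set} (E : Rel V 0ℓ) where

  -- Only `c` is subject to `P`, so what follows `c` on an arc with nonempty middle is again an arc,
  -- with `U` in place of `P`. The recursions on arcs rely on this.
  record Arc (P U Q : Pred V 0ℓ) (c : V) (r : List V) (e : V) : Set where
    constructor arc
    field
      start  : c ∈ P
      middle : All U r
      end    : e ∈ Q
      linked : Linked E (c ∷ r ∷ʳ e)

  -- The cycle is cut at the last node `a` of `P` before the nodes of `Q` and at the last node `b`
  -- of `Q` before those of `P`. Exchanging `P` and `Q` then exchanges the halves, and `flip`
  -- transfers each fact about one arc to the other.
  record AlternatingCycle (P U Q : Pred V 0ℓ) : Set where
    field
      P⊥Q   : P ⊥ Q
      P⊥U   : P ⊥ U
      Q⊥U   : Q ⊥ U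
      {a b} : V
      {l m} : List V
      a∈P   : a ∈ P
      b∈Q   : b ∈ Q
      l⊆    : All (Q ∪ U) l
      m⊆    : All (P ∪ U) m
      a⟶b   : Linked E (a ∷ l ∷ʳ b)
      b⟶a   : Linked E (b ∷ m ∷ʳ a)
      disjoint : Disjoint (a ∷ l) (b ∷ m)
      uniqueˡ  : Unique (a ∷ l)
      uniqueʳ  : Unique (b ∷ m)
      covers   : P ∪ Q ⊆ λ v → v ∈ₗ a ∷ l ⊎ v ∈ₗ b ∷ m

  flip : ∀ {P U Q} → AlternatingCycle P U Q → AlternatingCycle Q U P
  flip K = record
    { P⊥Q = P⊥Q ∘ swap ; P⊥U = Q⊥U ; Q⊥U = P⊥U ; a∈P = b∈Q ; b∈Q = a∈P ; l⊆ = m⊆ ; m⊆ = l⊆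
    ; a⟶b = b⟶a ; b⟶a = a⟶b ; disjoint = disjoint ∘ swap ; uniqueˡ = uniqueʳ ; uniqueʳ = uniqueˡ
    ; covers = λ v∈ → Sum.swap (covers (Sum.swap v∈))
    }
    where
    open AlternatingCycle K

  splitLinked : ∀ {c v l e} → v ∈ₗ l → Linked E (c ∷ l ∷ʳ e) →
    ∃[ pre ] ∃[ post ] l ≡ pre ++ v ∷ post × Linked E (c ∷ pre ∷ʳ v) × Linked E (v ∷ post ∷ʳ e)
  splitLinked {l = _ ∷ l} (here refl) (e ∷ L) = [] , l , refl , e ∷ [-] , L
  splitLinked (there v∈)  (e ∷ L)
    with pre , post , refl , L₁ , L₂ ← splitLinked v∈ L = _ ∷ pre , post , refl , e ∷ L₁ , L₂

  -- The arc stops at the first node of `Q` on `l`, or at `b` if there is none.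
  firstArc : ∀ {P U Q c b l} → c ∈ P → All (Q ∪ U) l → b ∈ Q → Linked E (c ∷ l ∷ʳ b) →
    ∃[ r ] ∃[ e ] Arc P U Q c r e
  firstArc {l = []}    c∈ []            b∈ L       = [] , _ , arc c∈ [] b∈ L
  firstArc {l = d ∷ _} c∈ (inj₁ d∈ ∷ _) b∈ (e ∷ _) = [] , d , arc c∈ [] d∈ (e ∷ [-])
  firstArc {U = U} {l = d ∷ _} c∈ (inj₂ d∈ ∷ l⊆) b∈ (e ∷ L)
    with r , z , arc _ r⊆ z∈ L′ ← firstArc {P = U} {c = d} d∈ l⊆ b∈ L
    = d ∷ r , z , arc c∈ (d∈ ∷ r⊆) z∈ (e ∷ L′)

  module _ (functional : ∀ {x y z} → E x y → E x z → y ≡ z) where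

    -- By functionality the two paths run in step, and whichever ends first puts a node into two
    -- disjoint sets.
    linked-stuck : ∀ {P U Q : Pred V 0ℓ} {c l e e′} r → P ⊥ Q → P ⊥ U → Q ⊥ U →
      Linked E (c ∷ l ∷ʳ e) → All (P ∪ U) l → e ∈ P →
      Linked E (c ∷ r ∷ʳ e′) → All U r → ¬ e′ ∈ Q
    linked-stuck {l = []} [] P⊥Q P⊥U Q⊥U (x ∷ _) [] e∈ (y ∷ _) [] e′∈
      with refl ← functional x y = P⊥Q (e∈ , e′∈)
    linked-stuck {l = []} (_ ∷ r) P⊥Q P⊥U Q⊥U (x ∷ _) [] e∈ (y ∷ _) (d∈ ∷ _) e′∈
      with refl ← functional x y = P⊥U (e∈ , d∈)
    linked-stuck {l = _ ∷ _} [] P⊥Q P⊥U Q⊥U (x ∷ _) (d∈ ∷ _) e∈ (y ∷ _) [] e′∈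
      with refl ← functional x y = case d∈ of λ where
        (inj₁ d∈P) → P⊥Q (d∈P , e′∈)
        (inj₂ d∈U) → Q⊥U (e′∈ , d∈U)
    linked-stuck {l = _ ∷ _} (_ ∷ r) P⊥Q P⊥U Q⊥U (x ∷ L) (_ ∷ l⊆) e∈ (y ∷ L′) (_ ∷ r⊆) e′∈
      with refl ← functional x y = linked-stuck r P⊥Q P⊥U Q⊥U L l⊆ e∈ L′ r⊆ e′∈

    -- The arcs run in step, and neither stops first, since its end in `Q` would be a middle node of
    -- the other and so in `U`.
    arc-unique : ∀ {P P′ U Q : Pred V 0ℓ} {c r e r′ e′} → Q ⊥ U → Arc P U Q c r e → Arc P′ U Q c r′ e′ →
      r ∷ʳ e ≡ r′ ∷ʳ e′
    arc-unique {r = []} {r′ = []} Q⊥U (arc _ _ _ (x ∷ _)) (arc _ _ _ (y ∷ _))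
      with refl ← functional x y = refl
    arc-unique {r = []} {r′ = _ ∷ _} Q⊥U (arc _ _ e∈ (x ∷ _)) (arc _ (d∈ ∷ _) _ (y ∷ _))
      with refl ← functional x y = ⊥-elim (Q⊥U (e∈ , d∈))
    arc-unique {r = _ ∷ _} {r′ = []} Q⊥U (arc _ (d∈ ∷ _) _ (x ∷ _)) (arc _ _ e∈ (y ∷ _))
      with refl ← functional x y = ⊥-elim (Q⊥U (e∈ , d∈))
    arc-unique {U = U} {r = _ ∷ _} {r′ = _ ∷ _} Q⊥U (arc _ (d∈ ∷ r⊆) e∈ (x ∷ L)) (arc _ (d∈′ ∷ r′⊆) e∈′ (y ∷ L′))
      with refl ← functional x y
      = cong (_ ∷_) (arc-unique {P = U} {P′ = U} Q⊥U (arc d∈ r⊆ e∈ L) (arc d∈′ r′⊆ e∈′ L′))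

    -- The path to `b` cannot stop within `r`, because `b` is in `Q` and `r` lies in `U`.
    initial⊆ : ∀ {U Q : Pred V 0ℓ} {c r e l b} → Q ⊥ U → All U r → Linked E (c ∷ r ∷ʳ e) →
      b ∈ Q → Linked E (c ∷ l ∷ʳ b) → ∀ {z} → z ∈ₗ c ∷ r → z ∈ₗ c ∷ l
    initial⊆ Q⊥U r⊆ L b∈ L′ (here refl) = here refl
    initial⊆ {r = _ ∷ _} {l = []} Q⊥U (d∈ ∷ _) (x ∷ _) b∈ (y ∷ _) (there _)
      with refl ← functional x y = ⊥-elim (Q⊥U (b∈ , d∈))
    initial⊆ {r = _ ∷ _} {l = _ ∷ _} Q⊥U (_ ∷ r⊆) (x ∷ L) b∈ (y ∷ L′) (there z∈)
      with refl ← functional x y = there (initial⊆ Q⊥U r⊆ L b∈ L′ z∈)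

    -- By functionality the walk has to follow the path, and it cannot end there before `e`.
    walk-past : ∀ {Q c l e t} → Linked E (c ∷ l ∷ʳ e) → ¬ t ∈ₗ c ∷ l → Walk E Q c t → Walk E Q e t
    walk-past L t∉ ε = contradiction (here refl) t∉
    walk-past {l = []} (x ∷ _) t∉ ((_ , y) ◅ w) with refl ← functional x y = w
    walk-past {l = _ ∷ _} (x ∷ L) t∉ ((_ , y) ◅ w)
      with refl ← functional x y = walk-past L (t∉ ∘ there) w

    walk-blocked : ∀ {n c l e t} → Linked E (c ∷ l ∷ʳ e) → ¬ t ∈ₗ c ∷ l → n ∈ₗ c ∷ l →
      ¬ Walk E (Avoiding n) c t
    walk-blocked L t∉ n∈ ε = t∉ (here refl)
    walk-blocked L t∉ (here refl) ((c≢n , _) ◅ _) = c≢n refl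
    walk-blocked {l = _ ∷ _} (x ∷ L) t∉ (there n∈) ((_ , y) ◅ w)
      with refl ← functional x y = walk-blocked L (t∉ ∘ there) n∈ w

    module _ {P U Q} (K : AlternatingCycle P U Q) where
      open AlternatingCycle K

      arc-exists : ∃[ r ] ∃[ e ] Arc P U Q a r e
      arc-exists = firstArc a∈P l⊆ b∈Q a⟶b

      -- The nodes of `l` and `b` are not in `P`. From a node of `m` the cycle runs through `P ∪ U`
      -- to `a` in `P`, so a path leaving `m` through `U` cannot reach `Q` first.
      arc-start : ∀ {c r e} → Arc P U Q c r e → a ≡ c
      arc-start {r = r} (arc c∈ r⊆ e∈ L) with covers (inj₁ c∈)
      ... | inj₁ (here refl) = refl
      ... | inj₁ (there c∈l) = case All.lookup l⊆ c∈l of λ where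
        (inj₁ c∈Q) → contradiction (c∈ , c∈Q) P⊥Q
        (inj₂ c∈U) → contradiction (c∈ , c∈U) P⊥U
      ... | inj₂ (here refl) = contradiction (c∈ , b∈Q) P⊥Q
      ... | inj₂ (there c∈m)
        with pre , post , refl , _ , L′ ← splitLinked c∈m b⟶a
        with _ , _ ∷ post⊆ ← ++⁻ pre m⊆
        = contradiction e∈ (linked-stuck r P⊥Q P⊥U Q⊥U L′ post⊆ a∈P L r⊆)

      arc⊆ : ∀ {c r e} → Arc P U Q c r e → ∀ {z} → z ∈ₗ c ∷ r → z ∈ₗ a ∷ l
      arc⊆ A with refl ← arc-start A = initial⊆ Q⊥U (Arc.middle A) (Arc.linked A) b∈Q a⟶b

    module _ {P U Q} (K : AlternatingCycle P U Q) where
      open AlternatingCycle K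

      arcs-disjoint : ∀ {c r e c′ r′ e′} → Arc P U Q c r e → Arc Q U P c′ r′ e′ →
        Disjoint (c ∷ r) (c′ ∷ r′)
      arcs-disjoint A B (z∈A , z∈B) = disjoint (arc⊆ K A z∈A , arc⊆ (flip K) B z∈B)

      -- Going round the cycle from P, the whole arc from P to Q precedes the arc from Q to P.
      no-overtaking : ∀ {c r e c′ r′ e′ v n t} → Arc P U Q c r e → Arc Q U P c′ r′ e′ →
        n ∈ₗ c ∷ r → t ∈ₗ c′ ∷ r′ → v ∈ P → ¬ Walk E (Avoiding n) v t
      no-overtaking {n = n} {t} A B n∈ t∈ v∈ w with covers (inj₁ v∈)
      ... | inj₁ (here refl) = fromA w
        where
        fromA : ¬ Walk E (Avoiding n) a t
        fromA with refl ← arc-start K A =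
          walk-blocked (Arc.linked A) (λ t∈A → arcs-disjoint A B (t∈A , t∈)) n∈
      ... | inj₁ (there v∈l) = case All.lookup l⊆ v∈l of λ where
        (inj₁ v∈Q) → P⊥Q (v∈ , v∈Q)
        (inj₂ v∈U) → P⊥U (v∈ , v∈U)
      ... | inj₂ (here refl) = P⊥Q (v∈ , b∈Q)
      -- The arc from `b` stops at the first node of `P`, so `t` lies on `b ∷ pre`, before `v`. By
      -- uniqueness it is not on `v ∷ post`, and the walk has to run on to `a`.
      ... | inj₂ (there v∈m)
        with refl ← arc-start (flip K) B
        with pre , post , refl , L₁ , L₂ ← splitLinked v∈m b⟶a
        with d , _ ← Unique-++⁻ (b ∷ pre) uniqueʳ
        = fromA (walk-past L₂ (λ t∈post → d (t∈pre , t∈post)) w)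
        where
        t∈pre = initial⊆ P⊥U (Arc.middle B) (Arc.linked B) v∈ L₁ t∈
        fromA : ¬ Walk E (Avoiding n) a t
        fromA with refl ← arc-start K A =
          walk-blocked (Arc.linked A) (λ t∈A → arcs-disjoint A B (t∈A , t∈)) n∈

-- Regular expressions over node sets

module _ {V : Set} where

  ⋆⇒All : ∀ {L : Language V} {Q : Pred V 0ℓ} → (∀ {u} → u ∈ L → All Q u) → ∀ {w} → w ∈ L ⋆ → All Q w
  ⋆⇒All f ε        = []
  ⋆⇒All f (u∈ ∷ w∈) = ++⁺ (f u∈) (⋆⇒All f w∈)

  ⟨⟩⇒All : ∀ {Q : Pred V 0ℓ} {u} → u ∈ ⟨ Q ⟩ → All Q u
  ⟨⟩⇒All (_ , v∈ , refl) = v∈ ∷ []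

  All⇒⋆ : ∀ {Q : Pred V 0ℓ} {w} → All Q w → w ∈ ⟨ Q ⟩ ⋆
  All⇒⋆ []       = ε
  All⇒⋆ (q ∷ qs) = (_ , q , refl) ∷ All⇒⋆ qs

  block⇒All : ∀ {P Q : Pred V 0ℓ} {w} → w ∈ (⟨ P ⟩ · ⟨ Q ⟩ ⋆) ⋆ → All (P ∪ Q) w
  block⇒All = ⋆⇒All λ where
    (_ , _ , refl , u∈ , v∈) → ++⁺ (All.map inj₁ (⟨⟩⇒All u∈)) (All.map inj₂ (⋆⇒All ⟨⟩⇒All v∈))

  -- The letter of the isolated factor `⟨ Q ⟩` is taken as `b`, which leaves only letters of `P` and
  -- `U` behind it.
  parse : ∀ {P Q U : Pred V 0ℓ} {w} →
    w ∈ ⟨ P ⟩ · ⟨ U ⟩ ⋆ · (⟨ Q ⟩ · ⟨ U ⟩ ⋆) ⋆ · ⟨ Q ⟩ · ⟨ U ⟩ ⋆ · (⟨ P ⟩ · ⟨ U ⟩ ⋆) ⋆ →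
    ∃[ a ] ∃[ l ] ∃[ b ] ∃[ m ]
      w ≡ a ∷ l ++ b ∷ m × a ∈ P × All (Q ∪ U) l × b ∈ Q × All (P ∪ U) m
  parse (_ , _ , refl , (a , a∈ , refl) , us , _ , refl , us∈ , qs , _ , refl , qs∈ ,
         _ , _ , refl , (b , b∈ , refl) , us′ , ps , refl , us′∈ , ps∈) =
    a , us ++ qs , b , us′ ++ ps , cong (a ∷_) (sym (++-assoc us qs _)) , a∈ ,
    ++⁺ (All.map inj₂ (⋆⇒All ⟨⟩⇒All us∈)) (block⇒All qs∈) , b∈ ,
    ++⁺ (All.map inj₂ (⋆⇒All ⟨⟩⇒All us′∈)) (block⇒All ps∈)

  allButLast-∷ʳ : ∀ (xs : List V) {y} → allButLast (xs ∷ʳ y) ≡ xs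
  allButLast-∷ʳ []           = refl
  allButLast-∷ʳ (_ ∷ [])     = refl
  allButLast-∷ʳ (x ∷ y ∷ xs) = cong (x ∷_) (allButLast-∷ʳ (y ∷ xs))

-- A third element would allow three successive removals, each lowering the cardinality, from a set
-- of size 2.
two-elements : ∀ {n} (q : Subset n) {s t u} → ∣ q ∣ ≡ 2 → s ≢ t → s ∈ₛ q → t ∈ₛ q → u ∈ₛ q →
  u ≡ s ⊎ u ≡ t
two-elements q {s} {t} {u} card s≢t s∈ t∈ u∈ with u ≟ s | u ≟ t
... | yes u≡s | _       = inj₁ u≡s
... | no _    | yes u≡t = inj₂ u≡t
... | no u≢s  | no u≢t  = contradiction 3≤card (λ { (s≤s (s≤s ())) })
  where
  s∈′ = x∈p∧x≢y⇒x∈p-y s∈ (≢-sym u≢s)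
  t∈′ = x∈p∧x≢y⇒x∈p-y (x∈p∧x≢y⇒x∈p-y t∈ (≢-sym u≢t)) (≢-sym s≢t)
  3≤card : 3 ≤ 2
  3≤card = subst (3 ≤_) card
    (≤-trans (s≤s (≤-trans (s≤s (≤-trans (s≤s z≤n) (x∈p⇒∣p-x∣<∣p∣ t∈′))) (x∈p⇒∣p-x∣<∣p∣ s∈′)))
             (x∈p⇒∣p-x∣<∣p∣ u∈))

-- Traces of a control flow graph from a node with two successors in A_p

module _ (G : CFG) (p : CFG.Vertex G) where
  open CFG G
  open DecMembership (_≟_ {size}) using () renaming (_∈?_ to _∈ₗ?_)

  private
    E : Rel Vertex 0ℓ
    E = Edge graph


    finitePath : ∀ {x xs} → Linked E (xs ∷ʳ x) → FinitePath graph (xs ∷ʳ x)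
    finitePath {xs = []}    L = (λ ()) , All.universal _ _ , L
    finitePath {xs = _ ∷ _} L = (λ ()) , All.universal _ _ , L

    -- Only infinite traces are considered. Finite maximal paths end in a sink, and `no-sink`
    -- excludes those once `p` has two successors in `A_p`.
    Unavoidable : Vertex → Vertex → Set
    Unavoidable v n = ∀ {f} → Trace E v f → ∃[ i ] f i ≡ n

  V∀ : Pred Vertex 0ℓ
  V∀ = OnAllMaximalPaths G p

  S : Pred Vertex 0ℓ
  S = V∀ ∖ ｛ p ｝

  p∈V∀ : p ∈ V∀
  p∈V∀ π mp = 0 , MaximalPathFrom.starts mp

  trace-maximal : ∀ {v f} → Trace E v f → MaximalPathFrom graph v (infinite f)
  trace-maximal (f0 , es) = record { isPath = (λ _ → tt) , es ; starts = cong just f0 ; maximal = tt }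

  V∀-unavoidable : ∀ {n} → n ∈ V∀ → Unavoidable p n
  V∀-unavoidable n∈ T = map₂ just-injective (n∈ _ (trace-maximal T))

  -- Going round the closed walk forever would give a trace that misses `n`.
  no-avoiding-cycle : ∀ {z u n} → Unavoidable z n → z ≢ n → E z u → ¬ Walk E (Avoiding n) u z
  no-avoiding-cycle unavoidable z≢n e w =
    let _ , T , avoids = loop z≢n e w
        i , eq = unavoidable T
    in avoids i eq

  ∉V∀⇒avoiding : ∀ {n} → n ∈ V∀ → ∁ V∀ ⊆ Avoiding n
  ∉V∀⇒avoiding n∈ v∉ refl = v∉ n∈

  -- The inner vertices lie outside `V∀`, so none of them is `n`. The first edge is split off to fit
  -- `no-avoiding-cycle`.
  interval-walk⁺ : ∀ {x y n} → n ∈ V∀ → Interval graph V∀ x y → ∃[ u ] E x u × Walk E (Avoiding n) u y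
  interval-walk⁺ n∈ (_ , _ , [] , _ , _ , _ , e ∷ _) = _ , e , ε
  interval-walk⁺ n∈ (_ , _ , m ∷ ms , ∉s , _ , _ , e ∷ L) =
    m , e , linked⇒walk (m ∷ ms) L refl (All.map (∉V∀⇒avoiding n∈) ∉s)

  interval-walk : ∀ {x y n} → n ∈ V∀ → x ≢ n → Interval graph V∀ x y → Walk E (Avoiding n) x y
  interval-walk n∈ x≢n I with _ , e , w ← interval-walk⁺ n∈ I = (x≢n , e) ◅ w

  entry-walk : ∀ {s n} → n ∈ Entry G p s → Walk E (∁ V∀) s n
  entry-walk (_ , ms , ∉s , hd , _ , _ , L) = linked⇒walk ms L hd ∉s

  interval-from : ∀ {x z n} → x ∈ V∀ → E x z → n ∈ Entry G p z → Interval graph V∀ x n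
  interval-from x∈ e (n∈ , ms , ∉s , hd , _ , _ , L) =
    x∈ , n∈ , ms , ∉s , finitePath {xs = _ ∷ ms} (Linked-∷ hd e L)

  -- An interval from `p` to itself would be a closed walk that avoids `y`.
  successor≢p : ∀ {x y} → y ∈ V∀ → x ≢ y → Interval graph V∀ p x → p ≢ x
  successor≢p y∈ x≢y I refl
    with _ , e , w ← interval-walk⁺ y∈ I = no-avoiding-cycle (V∀-unavoidable y∈) x≢y e w

  -- A walk that ends in a sink is a finite maximal path, and this one would miss `n`.
  no-avoiding-sink : ∀ {n q} → n ∈ V∀ → q ≢ n → Walk E (Avoiding n) p q → ¬ (∀ u → ¬ E q u)
  no-avoiding-sink {n} {q} n∈ q≢n w sink
    with xs , avoids , hd , L ← walk⇒linked w
    with i , eq ← n∈ (finite (xs ∷ʳ q)) record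
      { isPath  = finitePath L
      ; starts  = hd
      ; maximal = λ x eq → subst (λ x → ∀ u → ¬ E x u)
                                 (just-injective (trans (sym (last-∷ʳ xs)) eq)) sink
      }
    with ∈-++⁻ xs (occurs-finite (xs ∷ʳ q) i eq)
  ... | inj₁ n∈xs        = All.lookup avoids n∈xs refl
  ... | inj₂ (here refl) = q≢n refl

  -- Consequences of two successors in `A_p`: no sinks, no return to `p`, functionality of `C`

  module TwoSuccessors {x y : Vertex} (x≢y : x ≢ y)
    (p→x : Interval graph V∀ p x) (p→y : Interval graph V∀ p y) where

    x∈ : x ∈ V∀
    x∈ = proj₁ (proj₂ p→x)

    y∈ : y ∈ V∀
    y∈ = proj₁ (proj₂ p→y)

    p≢x : p ≢ x
    p≢x = successor≢p y∈ x≢y p→x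

    p≢y : p ≢ y
    p≢y = successor≢p x∈ (≢-sym x≢y) p→y

    -- Restarting at the last visit of x or y makes any walk from p avoid one of the two.
    bypass : ∀ {z} → Walk E Anywhere p z → Walk E (Avoiding x) p z ⊎ Walk E (Avoiding y) p z
    bypass w with lastVisit _≟_ x≢y w
    ... | inj₁ w′        = inj₁ (map (map₁ proj₁) w′)
    ... | inj₂ (inj₁ w′) = inj₂ (interval-walk y∈ p≢y p→x ◅◅ w′)
    ... | inj₂ (inj₂ w′) = inj₁ (interval-walk x∈ p≢x p→y ◅◅ w′)

    -- Extended backwards by the walk, the trace starts at `p` and must meet `n`, which cannot
    -- happen on the walk.
    hits-after : ∀ {n z} → n ∈ V∀ → Walk E (Avoiding n) p z → Unavoidable z n
    hits-after n∈ w T with k , g , T′ , past , _ ← prepend w T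
      with i , eq ← V∀-unavoidable n∈ T′
      with j , _ , eq′ ← past i eq (λ n≢n → n≢n refl) = j , eq′

    -- By `bypass` the trace must meet `x` or `y`. The interval from `p` to that node avoids `n`
    -- before its end, so `n` is met from there on.
    unavoidable : ∀ {n z} → n ∈ S → Walk E Anywhere p z → Unavoidable z n
    unavoidable {n} {z} (n∈ , p≢n) w {f} T with bypass w
    ... | inj₁ w′ with i , eq ← hits-after x∈ w′ T
                  with j , eq′ ← hits-after n∈ (interval-walk n∈ p≢n p→x) (Trace-drop {E = E} {f = f} i T eq) = j + i , eq′
    ... | inj₂ w′ with i , eq ← hits-after y∈ w′ T
                  with j , eq′ ← hits-after n∈ (interval-walk n∈ p≢n p→y) (Trace-drop {E = E} {f = f} i T eq) = j + i , eq′

    -- A sink would end a maximal path that misses `x` or `y`: the interval from `p` if the sink is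
    -- itself `x` or `y`, and otherwise the walk given by `bypass`.
    no-sink : ∀ {q} → Walk E Anywhere p q → ∃[ u ] E q u
    no-sink {q} w with any? (λ u → u ∈? succs q)
    ... | yes found = found
    ... | no none = ⊥-elim impossible
      where
      sink : ∀ u → ¬ E q u
      sink u e = none (u , e)

      impossible : _
      impossible with q ≟ x | q ≟ y | bypass w
      ... | yes refl | _        | _       = no-avoiding-sink y∈ x≢y (interval-walk y∈ p≢y p→x) sink
      ... | no _     | yes refl | _       = no-avoiding-sink x∈ (≢-sym x≢y) (interval-walk x∈ p≢x p→y) sink
      ... | no q≢x   | _        | inj₁ w′ = no-avoiding-sink x∈ q≢x w′ sink
      ... | no _     | no q≢y   | inj₂ w′ = no-avoiding-sink y∈ q≢y w′ sink

    trace-from : ∀ {z} → Walk E Anywhere p z → ∃[ f ] Trace E z f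
    trace-from w = map₂ proj₁ (unfoldTrace (Walk E Anywhere p) step w)
      where
      step : ∀ {v} → Walk E Anywhere p v → ∃[ u ] E v u × Walk E Anywhere p u
      step w with u , e ← no-sink w = u , e , (w ◅◅ (_ , e) ◅ ε)

    walk-to : ∀ {z n} → Walk E Anywhere p z → Unavoidable z n → Walk E Anywhere z n
    walk-to w un with f , T@(refl , es) ← trace-from w
      with j , refl ← un T = prefixWalk es j (λ _ _ → _)

    reachable : ∀ {n} → n ∈ V∀ → Walk E Anywhere p n
    reachable n∈ = walk-to ε (V∀-unavoidable n∈)

    -- Rerouted at its last visit of `x` or `y`, a return to `p` becomes a closed walk that avoids
    -- one of the two.
    no-return : ∀ {s} → E p s → ¬ Walk E Anywhere s p
    no-return e w with lastVisit _≟_ x≢y w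
    ... | inj₁ w′ = no-avoiding-cycle (V∀-unavoidable x∈) p≢x e (map (map₁ proj₁) w′)
    ... | inj₂ (inj₁ w′) with _ , e′ , w″ ← interval-walk⁺ y∈ p→x =
      no-avoiding-cycle (V∀-unavoidable y∈) p≢y e′ (w″ ◅◅ w′)
    ... | inj₂ (inj₂ w′) with _ , e′ , w″ ← interval-walk⁺ x∈ p→y =
      no-avoiding-cycle (V∀-unavoidable x∈) p≢x e′ (w″ ◅◅ w′)

    no-avoiding-interval-cycle : ∀ {z u n} → z ∈ V∀ → n ∈ S → z ≢ n → Interval graph V∀ z u →
      ¬ Walk E (Avoiding n) u z
    no-avoiding-interval-cycle z∈ n∈@(n∈V , _) z≢n I w
      with _ , e , w′ ← interval-walk⁺ n∈V I =
      no-avoiding-cycle (unavoidable n∈ (reachable z∈)) z≢n e (w′ ◅◅ w)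

    -- If z had two successors u ≢ v in C, some return from them to z would avoid u or v forever.
    C-functional : ∀ {z u v} → Edge (C G p) z u → Edge (C G p) z v → u ≡ v
    C-functional {z} {u} {v} (z→u , z∈ , u∈) (z→v , _ , v∈) with u ≟ v
    ... | yes u≡v = u≡v
    ... | no u≢v = ⊥-elim impossible
      where
      impossible : _
      impossible with z ≟ u | z ≟ v
      ... | yes refl | _        = no-avoiding-interval-cycle (proj₁ z∈) v∈ u≢v z→u ε
      ... | no z≢u   | yes refl = no-avoiding-interval-cycle (proj₁ z∈) u∈ z≢u z→v ε
      ... | no z≢u   | no z≢v
        with lastVisit _≟_ u≢v (walk-to (reachable (proj₁ u∈)) (unavoidable z∈ (reachable (proj₁ u∈))))
      ... | inj₁ w        = no-avoiding-interval-cycle (proj₁ z∈) v∈ z≢v z→u (map (map₁ proj₂) w)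
      ... | inj₂ (inj₁ w) = no-avoiding-interval-cycle (proj₁ z∈) v∈ z≢v z→u w
      ... | inj₂ (inj₂ w) = no-avoiding-interval-cycle (proj₁ z∈) u∈ z≢u z→v w

    expand : ∀ {n s t} → n ∈ V∀ → Walk (Edge (C G p)) (Avoiding n) s t → Walk E (Avoiding n) s t
    expand n∈ ε = ε
    expand n∈ ((s≢n , I , _) ◅ w) = interval-walk n∈ s≢n I ◅◅ expand n∈ w

    -- Compressing walks of the graph to paths of `C`

    module Decidable (inV? : ∀ v → Dec (v ∈ V∀)) where

      -- The walk is read from its end. A vertex outside `V∀` lengthens the stretch leading to the
      -- entry node `n`; a vertex of `V∀` becomes the new entry node, joined to the old one by an
      -- interval. It is not `p` because of `no-return`.
      compress : ∀ {Q s z t} → E p s → Walk E Anywhere s z → t ∈ S → Walk E Q z t →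
        ∃[ n ] n ∈ Entry G p z × n ∈ S × Walk (Edge (C G p)) Q n t
      compress e r t∈ ε = _ , (proj₁ t∈ , [] , [] , refl , finitePath {xs = []} [-]) , t∈ , ε
      compress {z = z} e r t∈ ((q , e′) ◅ w)
        with n , n∈@(n∈V , ms , ∉s , hd , _ , _ , L) , n∈S , w′ ← compress e (r ◅◅ (_ , e′) ◅ ε) t∈ w
        with inV? z
      ... | no z∉ = n , (n∈V , z ∷ ms , z∉ ∷ ∉s , refl , finitePath {xs = z ∷ ms} (Linked-∷ hd e′ L)) , n∈S , w′
      ... | yes z∈ = z , (z∈ , [] , [] , refl , finitePath {xs = []} [-]) , z∈S
                       , (q , interval-from z∈ e′ n∈ , z∈S , n∈S) ◅ w′
        where
        z∈S : z ∈ S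
        z∈S = z∈ , λ { refl → no-return e r }

      reachable⁺ : ∀ {z} → z ∈ S → ∃[ s ] E p s × Walk E Anywhere s z
      reachable⁺ (z∈ , p≢z) with reachable z∈
      ... | ε = contradiction refl p≢z
      ... | (_ , e) ◅ w = _ , e , w

      -- The walk from a successor of `z` on to `a` first meets `C` in some `n`, which makes `n` the
      -- target of an edge from `z`. If `n` were on `xs`, the path from `n` to `z` would close a
      -- cycle avoiding `a`.
      closing-edge : ∀ {a xs z} → Linked (Edge (C G p)) (a ∷ xs) → All (Avoiding a) xs →
        All S (a ∷ xs) → (∀ v → v ∈ S → v ∈ₗ a ∷ xs) → last xs ≡ just z →
        Edge (C G p) z a
      closing-edge {z = z} L avoids (a∈ ∷ xs∈) covers last≡z
        with z∈ ← All-last xs∈ last≡z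
        with s , e , w ← reachable⁺ z∈
        with u , e′ ← no-sink (reachable (proj₁ z∈))
        with r ← w ◅◅ (_ , e′) ◅ ε
        with w′ ← walk-to ((_ , e) ◅ r) (unavoidable a∈ ((_ , e) ◅ r))
        with n , n∈ , n∈S , _ ← compress e r a∈ w′
        with z→n ← interval-from (proj₁ z∈) e′ n∈
        with covers n n∈S
      ... | here refl = z→n , z∈ , a∈
      ... | there n∈xs = ⊥-elim
        (no-avoiding-interval-cycle (proj₁ z∈) a∈ (All-last avoids last≡z) z→n
          (expand (proj₁ a∈) (walkToLast (Linked.tail L) avoids n∈xs last≡z)))

      -- Arcs of `C` and the order of nodes on maximal paths

      Cycle : (P U Q : Pred Vertex 0ℓ) → Set
      Cycle = AlternatingCycle (Edge (C G p))

      CArc : (P U Q : Pred Vertex 0ℓ) → Vertex → List Vertex → Vertex → Set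
      CArc = Arc (Edge (C G p))

      -- A finite maximal path would end in a sink. On an infinite one, a `t` not after the first
      -- `n` gives a walk from `s` to `t` avoiding `n`, whose compression enters `C` in
      -- `Entry G p s` and contradicts `no-overtaking`.
      arcs⇒before : ∀ {U : Pred Vertex 0ℓ} {s s′ c r e c′ r′ e′ n t} → E p s →
        Cycle (Entry G p s) U (Entry G p s′) →
        CArc (Entry G p s) U (Entry G p s′) c r e → CArc (Entry G p s′) U (Entry G p s) c′ r′ e′ →
        n ∈ₗ c ∷ r → t ∈ₗ c′ ∷ r′ → n ∈ S → t ∈ S →
        ∀ π → MaximalPathFrom graph s π → n occursIn π beforeAny t
      arcs⇒before e K A B n∈A t∈B n∈ t∈ (finite xs) mp with initLast xs
      ... | [] = contradiction refl (proj₁ (MaximalPathFrom.isPath mp))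
      ... | ys ∷ʳ′ q
        with _ , _ , L ← MaximalPathFrom.isPath mp
        with u , e′ ← no-sink ((_ , e) ◅ linked⇒walk ys L (MaximalPathFrom.starts mp) (All.universal _ ys))
        = contradiction e′ (MaximalPathFrom.maximal mp q (last-∷ʳ ys) u)
      arcs⇒before {n = n} {t} e K A B n∈A t∈B n∈ t∈ (infinite f) mp
        with refl ← MaximalPathFrom.starts mp
        with _ , es ← MaximalPathFrom.isPath mp
        with i₀ , eq₀ ← unavoidable n∈ ((_ , e) ◅ ε) (refl , es)
        with i , eq , before ← firstOccurrence _≟_ f i₀ eq₀
        = i , cong just eq , first
        where
        first : ∀ j → just (f j) ≡ just t → i < j
        first j eq′ with i <? j
        ... | yes i<j = i<j
        ... | no i≮j
          with refl ← just-injective eq′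
          with v , v∈ , _ , w ← compress e ε t∈ (prefixWalk es j (λ k k<j → before k (<-≤-trans k<j (≮⇒≥ i≮j))))
          = ⊥-elim (no-overtaking (Edge (C G p)) C-functional K A B n∈A t∈B v∈ w)

      -- If n were not on the arc, a trace entering through s could run along the whole arc and
      -- then join a trace entering through s′ at e, on which t precedes n.
      before⇒arc : ∀ {P Q U : Pred Vertex 0ℓ} {s s′ c r e n t} → P ⊆ Entry G p s → Q ⊆ Entry G p s′ →
        CArc P U Q c r e → n ∈ S → t ∈ S →
        (∀ π → MaximalPathFrom graph s π → n occursIn π beforeAny t) →
        (∀ π → MaximalPathFrom graph s′ π → t occursIn π beforeAny n) →
        n ∈ₗ c ∷ r
      before⇒arc {c = c} {r} {e} {n} {t} P⊆ Q⊆ (arc c∈ _ e∈ L) (n∈ , _) (t∈ , _) nFirst tFirst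
        with n ∈ₗ? c ∷ r
      ... | yes found = found
      ... | no n∉ = ⊥-elim impossible
        where
        c⇝e : Walk E (Avoiding n) c e
        c⇝e = expand n∈ (linked⇒walk (c ∷ r) L refl
          (All.tabulate λ { v∈ refl → n∉ v∈ }))

        s⇝e : Walk E (Avoiding n) _ e
        s⇝e = map (map₁ (∉V∀⇒avoiding n∈)) (entry-walk (P⊆ c∈)) ◅◅ c⇝e

        s′⇝e : Walk E (Avoiding t) _ e
        s′⇝e = map (map₁ (∉V∀⇒avoiding t∈)) (entry-walk (Q⊆ e∈))

        impossible : _
        impossible
          with f , T ← trace-from (reachable (proj₁ (Q⊆ e∈)))
          with k , g , Tg , past , after ← prepend s⇝e T
             | k′ , g′ , Tg′ , past′ , after′ ← prepend s′⇝e T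
          with i , eq , n<t ← nFirst (infinite g) (trace-maximal Tg)
             | i′ , eq′ , t<n ← tFirst (infinite g′) (trace-maximal Tg′)
          with j , refl , fj ← past i (just-injective eq) (λ n≢n → n≢n refl)
             | j′ , refl , fj′ ← past′ i′ (just-injective eq′) (λ t≢t → t≢t refl)
          -- Both traces end in the common tail `f`, with `n` at `j` and `t` at `j′`. The trace `g`
          -- yields `j < j′`, the trace `g′` yields `j′ < j`.
          = <-asym (+-cancelˡ-< k j j′ (n<t (k + j′) (cong just (trans (after j′) fj′))))
                   (+-cancelˡ-< k′ j′ j (t<n (k′ + j) (cong just (trans (after′ j) fj))))

      -- Arcs of `C` as words of the regular languages

      C-nodes : ∀ {c xs} → c ∈ S → Linked (Edge (C G p)) (c ∷ xs) → All (Node (C G p)) (c ∷ xs)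
      C-nodes c∈ [-]                  = (proj₁ c∈ , c∈) ∷ []
      C-nodes c∈ ((_ , _ , d∈) ∷ L) = (proj₁ c∈ , c∈) ∷ C-nodes d∈ L

      Word : (P U Q : Pred Vertex 0ℓ) → Pred (List Vertex) 0ℓ
      Word P U Q ms = FinitePath (C G p) ms × ms ∈ ⟨ P ⟩ · ⟨ U ⟩ ⋆ · ⟨ Q ⟩

      arc⇒word : ∀ {P U Q : Pred Vertex 0ℓ} {c r e} → CArc P U Q c r e → Word P U Q (c ∷ r ∷ʳ e)
      arc⇒word {r = r} (arc c∈ r⊆ e∈ L)
        = ((λ ()) , C-nodes (source r L) L , L)
        , _ , _ , refl , (_ , c∈ , refl) , _ , _ , refl , All⇒⋆ r⊆ , _ , e∈ , refl
        where
        source : ∀ {c e} r → Linked (Edge (C G p)) (c ∷ r ∷ʳ e) → c ∈ S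
        source []      ((_ , c∈ , _) ∷ _) = c∈
        source (_ ∷ _) ((_ , c∈ , _) ∷ _) = c∈

      arc⊆S : ∀ {P U Q : Pred Vertex 0ℓ} {c r e n} → CArc P U Q c r e → n ∈ₗ c ∷ r → n ∈ S
      arc⊆S A n∈ with (_ , nodes , _) , _ ← arc⇒word A = proj₂ (All.lookup nodes (∈-++⁺ˡ n∈))

      word⇒arc : ∀ {P U Q : Pred Vertex 0ℓ} {ms} → Word P U Q ms →
        ∃[ c ] ∃[ r ] ∃[ e ] ms ≡ c ∷ r ∷ʳ e × CArc P U Q c r e
      word⇒arc ((_ , _ , L) , _ , _ , refl , (c , c∈ , refl) , r , _ , refl , r∈ , e , e∈ , refl) =
        c , r , e , refl , arc c∈ (⋆⇒All ⟨⟩⇒All r∈) e∈ L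

      unique-word : ∀ {P U Q : Pred Vertex 0ℓ} → Cycle P U Q → ∃! _≡_ (Word P U Q)
      unique-word {P} K
        with r , e , A ← arc-exists (Edge (C G p)) C-functional K
        = _ , arc⇒word A , λ W → unique (word⇒arc W)
        where
        open AlternatingCycle K using (a; Q⊥U)
        unique : ∀ {ms} → ∃[ c ] ∃[ r′ ] ∃[ e′ ] ms ≡ c ∷ r′ ∷ʳ e′ × CArc P _ _ c r′ e′ → a ∷ r ∷ʳ e ≡ ms
        unique (_ , _ , _ , refl , B) with refl ← arc-start (Edge (C G p)) C-functional K B =
          cong (a ∷_) (arc-unique (Edge (C G p)) C-functional {P = P} {P′ = P} Q⊥U A B)

      unfolding⇒cycle : ∀ {s₁ s₂ w} → E p s₁ → E p s₂ →
        let V₁ = Entry G p s₁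
            V₂ = Entry G p s₂
            U  = V∀ ∖ (V₁ ∪ V₂)
        in V₁ ⊥ V₂ → Unfolding (C G p) w →
        w ∈ ⟨ V₁ ⟩ · ⟨ U ⟩ ⋆ · (⟨ V₂ ⟩ · ⟨ U ⟩ ⋆) ⋆ · ⟨ V₂ ⟩ · ⟨ U ⟩ ⋆ · (⟨ V₁ ⟩ · ⟨ U ⟩ ⋆) ⋆ →
        Cycle V₁ U V₂
      unfolding⇒cycle e₁ e₂ V₁⊥V₂ ((_ , nodes , L) , unique , covers) w∈
        with a , l , b , m , refl , a∈ , l⊆ , b∈ , m⊆ ← parse w∈
        with z , last≡z ← last-of-∷ b m
        with a∉ ∷ _ ← unique
        with disjoint , uniqueˡ , uniqueʳ ← Unique-++⁻ (a ∷ l) unique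
        with z→a ← closing-edge L (All.map ≢-sym a∉) (All.map proj₂ nodes) (λ v v∈ → covers v (proj₁ v∈ , v∈))
                     (trans (last-++ l) last≡z)
        = record
        { P⊥Q = V₁⊥V₂
        ; P⊥U = λ (v∈ , _ , v∉) → v∉ (inj₁ v∈)
        ; Q⊥U = λ (v∈ , _ , v∉) → v∉ (inj₂ v∈)
        ; a∈P = a∈ ; b∈Q = b∈ ; l⊆ = l⊆ ; m⊆ = m⊆
        ; a⟶b = Linked-++⁻ˡ (a ∷ l ∷ʳ b) (subst (Linked _) (cong (a ∷_) (sym (++-assoc l [ b ] m))) L)
        -- The unfolding ends with `b ∷ m`, and the edge from its last node `z` back to `a` closes
        -- the cycle.
        ; b⟶a = Linked.++⁺ (Linked-++⁻ʳ (a ∷ l) L)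
                  (subst (λ z → Connected _ z (just a)) (sym last≡z) (just z→a))
                  [-]
        ; disjoint = disjoint ; uniqueˡ = uniqueˡ ; uniqueʳ = uniqueʳ
        ; covers = λ { (inj₁ v∈) → ∈-++⁻ (a ∷ l) (covers _ (node e₁ v∈))
                     ; (inj₂ v∈) → ∈-++⁻ (a ∷ l) (covers _ (node e₂ v∈)) }
        }
        where
        node : ∀ {s v} → E p s → v ∈ Entry G p s → v ∈ Node (C G p)
        -- If the entry node were `p`, the entry path would lead from a successor of `p` back to
        -- `p`.
        node e v∈@(v∈V , _) = v∈V , v∈V , λ { refl → no-return e (map (map₁ _) (entry-walk v∈)) }

theorem4p15 :
    (G : CFG) (p s₁ s₂ : CFG.Vertex G) →
    PredicateWithSuccessors G p s₁ s₂ →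
    AtLeastTwoSuccessors (A G p) p →
    let V₁ = Entry G p s₁
        V₂ = Entry G p s₂
        U  = OnAllMaximalPaths G p ∖ (V₁ ∪ V₂)
        PathM = λ (ms : List (CFG.Vertex G)) →
                  FinitePath (C G p) ms × ms ∈ ⟨ V₁ ⟩ · ⟨ U ⟩ ⋆ · ⟨ V₂ ⟩
        PathO = λ (os : List (CFG.Vertex G)) →
                  FinitePath (C G p) os × os ∈ ⟨ V₂ ⟩ · ⟨ U ⟩ ⋆ · ⟨ V₁ ⟩
    in
    V₁ ⊥ V₂ →
    (∃[ w ] Unfolding (C G p) w ×
      w ∈ ⟨ V₁ ⟩ · ⟨ U ⟩ ⋆ · (⟨ V₂ ⟩ · ⟨ U ⟩ ⋆) ⋆ · ⟨ V₂ ⟩ · ⟨ U ⟩ ⋆ · (⟨ V₁ ⟩ · ⟨ U ⟩ ⋆) ⋆) →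
    ∃! _≡_ PathM × ∃! _≡_ PathO ×
    (∀ ms os → PathM ms → PathO os → ∀ a b →
      DOD G p a b ⇔
        ((a ∈ₗ allButLast ms × b ∈ₗ allButLast os) ⊎
         (b ∈ₗ allButLast ms × a ∈ₗ allButLast os)))
theorem4p15 G p s₁ s₂ isPredicate (x , y , x≢y , p→x , p→y) V₁⊥V₂ (w , unf@((_ , nodes , _) , _ , covers) , w∈) =
  unique-word K , unique-word (flip _ K) , λ ms os M O a b → equivalence (word⇒arc M) (word⇒arc O)
  where
  open PredicateWithSuccessors isPredicate
  open CFG G using (Vertex; graph; size; succs)
  open DecMembership (_≟_ {size}) using () renaming (_∈?_ to _∈ₗ?_)

  V₁ V₂ U : Pred Vertex 0ℓ
  V₁ = Entry G p s₁
  V₂ = Entry G p s₂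
  U  = V∀ G p ∖ (V₁ ∪ V₂)

  -- The unfolding lists every node of `V∀` other than `p`, so membership can be read off from `w`.
  inV? : ∀ v → Dec (v ∈ V∀ G p)
  inV? v with p ≟ v | v ∈ₗ? w
  ... | yes refl | _       = yes (p∈V∀ G p)
  ... | no _     | yes v∈w = yes (proj₁ (All.lookup nodes v∈w))
  ... | no p≢v   | no v∉w  = no λ v∈ → v∉w (covers v (v∈ , v∈ , p≢v))

  open TwoSuccessors G p x≢y p→x p→y using (C-functional)
  open TwoSuccessors.Decidable G p x≢y p→x p→y inV?

  K : Cycle V₁ U V₂
  K = unfolding⇒cycle edge₁ edge₂ V₁⊥V₂ unf w∈

  _precedes_from_ : Vertex → Vertex → Vertex → Set
  a precedes b from s = ∀ π → MaximalPathFrom graph s π → a occursIn π beforeAny b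

  equivalence : ∀ {ms os a b} →
    ∃[ c ] ∃[ r ] ∃[ e ] ms ≡ c ∷ r ∷ʳ e × CArc V₁ U V₂ c r e →
    ∃[ c ] ∃[ r ] ∃[ e ] os ≡ c ∷ r ∷ʳ e × CArc V₂ U V₁ c r e →
    DOD G p a b ⇔ ((a ∈ₗ allButLast ms × b ∈ₗ allButLast os) ⊎ (b ∈ₗ allButLast ms × a ∈ₗ allButLast os))
  equivalence {a = a} {b} (c , r , e , refl , M) (c′ , r′ , e′ , refl , O)
    rewrite allButLast-∷ʳ (c ∷ r) {e} | allButLast-∷ʳ (c′ ∷ r′) {e′} = mk⇔ to from
    where
    separate : ∀ {a b} → a ∈ₗ c ∷ r → b ∈ₗ c′ ∷ r′ →
      a ∈ S G p × b ∈ S G p × a ≢ b × a precedes b from s₁ × b precedes a from s₂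
    separate a∈ b∈ =
      arc⊆S M a∈ , arc⊆S O b∈ ,
      (λ { refl → arcs-disjoint _ C-functional K M O (a∈ , b∈) }) ,
      arcs⇒before edge₁ K M O a∈ b∈ (arc⊆S M a∈) (arc⊆S O b∈) ,
      arcs⇒before edge₂ (flip _ K) O M b∈ a∈ (arc⊆S O b∈) (arc⊆S M a∈)

    in-arcs : ∀ {a b} → a ∈ S G p → b ∈ S G p → a precedes b from s₁ → b precedes a from s₂ →
      a ∈ₗ c ∷ r × b ∈ₗ c′ ∷ r′
    in-arcs a∈ b∈ aFirst bFirst =
      before⇒arc (λ v∈ → v∈) (λ v∈ → v∈) M a∈ b∈ aFirst bFirst ,
      before⇒arc (λ v∈ → v∈) (λ v∈ → v∈) O b∈ a∈ bFirst aFirst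

    to : DOD G p a b → (a ∈ₗ c ∷ r × b ∈ₗ c′ ∷ r′) ⊎ (b ∈ₗ c ∷ r × a ∈ₗ c′ ∷ r′)
    -- Since `p` has only two successors, those named in `D` are `s₁` and `s₂` in one of two orders,
    -- which correspond to the two alternatives.
    to D = orient (two-elements _ twoSuccessors distinct edge₁ edge₂ D.edge₁)
                  (two-elements _ twoSuccessors distinct edge₁ edge₂ D.edge₂)
      where
      module D where
        open DOD D public
        open PredicateWithSuccessors predicate public
      a∈ : a ∈ S G p
      a∈ = (λ π mp → proj₁ (D.containBoth π mp)) , D.p≢a
      b∈ : b ∈ S G p
      b∈ = (λ π mp → proj₂ (D.containBoth π mp)) , D.p≢b
      orient : D.s₁ ≡ s₁ ⊎ D.s₁ ≡ s₂ → D.s₂ ≡ s₁ ⊎ D.s₂ ≡ s₂ → _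
      orient (inj₁ refl) (inj₁ refl) = contradiction refl D.distinct
      orient (inj₁ refl) (inj₂ refl) = inj₁ (in-arcs a∈ b∈ D.aFirst D.bFirst)
      orient (inj₂ refl) (inj₁ refl) = inj₂ (in-arcs b∈ a∈ D.bFirst D.aFirst)
      orient (inj₂ refl) (inj₂ refl) = contradiction refl D.distinct

    from : (a ∈ₗ c ∷ r × b ∈ₗ c′ ∷ r′) ⊎ (b ∈ₗ c ∷ r × a ∈ₗ c′ ∷ r′) → DOD G p a b
    from (inj₁ (a∈ , b∈)) with (a∈V , p≢a) , (b∈V , p≢b) , a≢b , aFirst , bFirst ← separate a∈ b∈ = record
      { p≢a = p≢a ; p≢b = p≢b ; a≢b = a≢b ; predicate = isPredicate
      ; containBoth = λ π mp → a∈V π mp , b∈V π mp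
      ; aFirst = aFirst ; bFirst = bFirst }
    from (inj₂ (b∈ , a∈)) with (b∈V , p≢b) , (a∈V , p≢a) , b≢a , bFirst , aFirst ← separate b∈ a∈ = record
      { p≢a = p≢a ; p≢b = p≢b ; a≢b = ≢-sym b≢a
      ; predicate = record { twoSuccessors = twoSuccessors ; distinct = ≢-sym distinct ; edge₁ = edge₂ ; edge₂ = edge₁ }
      ; containBoth = λ π mp → a∈V π mp , b∈V π mp
      ; aFirst = aFirst ; bFirst = bFirst }
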